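{- Let $\mathbb{A} = \{\mathscr{A}_1, \mathscr{A}_2, \dots\}$ be a set of architectures and let $\mathbb{H}_A$ be the set of all architecture homomorphisms between members of $\mathbb{A}$. Then the pair $\langle \mathbb{A}, \mathbb{H}_A\rangle$ (objects: the architectures in $\mathbb{A}$; arrows: the homomorphisms in $\mathbb{H}_A$) forms a category.
   Context: An architecture is a triple $\mathscr{A} = \langle A, \mathbf{R}^A, \mathbf{F}^A\rangle$ where $A$ is a (possibly empty) set, called the universe; $\mathbf{R}^A$ is a countable set of relations over $A$, each $R \in \mathbf{R}^A$ being a subset $R\subseteq A^{k}$ for some arity $k=\alpha(R)\in\mathbb{N}$; and $\mathbf{F}^A$ is a countable set of functions $f: \mathrm{dom}(f) \to A$ with $\mathrm{dom}(f)\subseteq A^{m}$ for some arity $m=\alpha(f)\in\mathbb{N}$. One writes $R(a_1,\dots,a_k)$ for $(a_1,\dots,a_k)\in R$. A homomorphism $h:\mathscr{A}\to\mathscr{B}$ between architectures $\mathscr{A} = \langle A, \mathbf{R}^A, \mathbf{F}^A\rangle$ and $\mathscr{B} = \langle B, \mathbf{R}^B, \mathbf{F}^B\rangle$ is a triple $h=\langle h_0,h_R,h_F\rangle$ of maps $h_0:A\to B$, $h_R:\mathbf{R}^A\to\mathbf{R}^B$, $h_F:\mathbf{F}^A\to\mathbf{F}^B$ such that $h_R$ and $h_F$ preserve arity ($\alpha(h_R(R))=\alpha(R)$, $\alpha(h_F(f))=\alpha(f)$), and (i) for every $R\in\mathbf{R}^A$: $R(a_1,\dots,a_m)\Rightarrow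 h_R(R)(h_0(a_1),\dots,h_0(a_m))$; (ii) for every $f\in\mathbf{F}^A$ and every $(a_1,\dots,a_k)\in\mathrm{dom}(f)$: $h_0(f(a_1,\dots,a_k)) = h_F(f)(h_0(a_1),\dots,h_0(a_k))$ (in particular the right-hand side is defined). Composition of homomorphisms is componentwise, $g\circ f=\langle g_0\circ f_0, g_R\circ f_R, g_F\circ f_F\rangle$, and the identity arrow of $\mathscr{A}$ is $\langle \mathrm{id}_A,\mathrm{id}_{\mathbf{R}^A},\mathrm{id}_{\mathbf{F}^A}\rangle$. -}

module Defs where

open import Data.Maybe.Base using (Maybe)
open import Data.Maybe.Relation.Unary.Any using (Any)
open import Data.Nat.Base using (ℕ)
open import Data.Product.Base using (Σ; ∃; _,_; proj₁; proj₂)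
open import Data.Refinement using (Refinement; value)
open import Data.Vec.Base using (Vec; map; cast)
open import Function.Base using (id; _∘_; _on_)
open import Function.Bundles using (Func; _⟨$⟩_)
import Function.Construct.Composition as Composition
import Function.Construct.Identity as Identity
open import Level using (Level; _⊔_; suc)
open import Relation.Binary.Bundles using (Setoid)
open import Relation.Binary.Core using (Rel)
import Relation.Binary.Construct.On as On
open import Relation.Binary.PropositionalEquality.Core
  using (_≡_; refl; sym; trans; _≗_)
open import Relation.Binary.Structures using (IsEquivalence)
open import Relation.Unary using (Pred; _∈_; _≐_)
open import Relation.Unary.Properties using (≐-refl; ≐-sym; ≐-trans)

private
  variable
    a ℓ m s o h e : Level

-- The arity is part of a relation, so that the empty relations of
-- different arities are distinct.
record Relation (A : Set a) (ℓ : Level) : Set (a ⊔ suc ℓ) where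
  constructor mkRelation
  field
    arity : ℕ
    holds : Pred (Vec A arity) ℓ

-- Since membership in the domain may be proof-relevant, the value is required
-- to depend on the tuple only.
record PartialFunction (A : Set a) (ℓ : Level) : Set (a ⊔ suc ℓ) where
  constructor mkPartialFunction
  field
    arity       : ℕ
    dom         : Pred (Vec A arity) ℓ
    apply       : ∀ v → v ∈ dom → A
    apply-irrel : ∀ v (p q : v ∈ dom) → apply v p ≡ apply v q

-- Extensional equality: same arity and same tuples.
data _≈ᴿ_ {A : Set a} {ℓ : Level} : Rel (Relation A ℓ) (a ⊔ suc ℓ) where
  ext : ∀ {k} {P Q : Pred (Vec A k) ℓ} →
        P ≐ Q → mkRelation k P ≈ᴿ mkRelation k Q

-- Extensional equality: same arity, same domain and same values.
data _≈ᶠ_ {A : Set a} {ℓ : Level} : Rel (PartialFunction A ℓ) (a ⊔ suc ℓ) where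
  ext : ∀ {k} {D E : Pred (Vec A k) ℓ} {f g f-irrel g-irrel} →
        D ≐ E → (∀ v (p : v ∈ D) (q : v ∈ E) → f v p ≡ g v q) →
        mkPartialFunction k D f f-irrel ≈ᶠ mkPartialFunction k E g g-irrel

≈ᴿ-isEquivalence : {A : Set a} → IsEquivalence (_≈ᴿ_ {A = A} {ℓ})
≈ᴿ-isEquivalence = record
  { refl  = ext ≐-refl
  ; sym   = λ { (ext p) → ext (≐-sym p) }
  ; trans = λ { (ext p) (ext q) → ext (≐-trans p q) }
  }

≈ᶠ-isEquivalence : {A : Set a} → IsEquivalence (_≈ᶠ_ {A = A} {ℓ})
≈ᶠ-isEquivalence = record
  { refl  = λ {f} → ext ≐-refl (PartialFunction.apply-irrel f)
  ; sym   = λ { (ext d eq) → ext (≐-sym d) (λ v p q → sym (eq v q p)) }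
  ; trans = λ { (ext d eq) (ext d′ eq′) →
                ext (≐-trans d d′)
                    (λ v p r → trans (eq v p (proj₁ d p)) (eq′ v (proj₁ d p) r)) }
  }

relationSetoid : Set a → (ℓ : Level) → Setoid (a ⊔ suc ℓ) (a ⊔ suc ℓ)
relationSetoid A ℓ = record { isEquivalence = ≈ᴿ-isEquivalence {ℓ = ℓ} {A = A} }

functionSetoid : Set a → (ℓ : Level) → Setoid (a ⊔ suc ℓ) (a ⊔ suc ℓ)
functionSetoid A ℓ = record { isEquivalence = ≈ᶠ-isEquivalence {ℓ = ℓ} {A = A} }

-- The members of a subset, compared in the ambient setoid: the membership
-- proofs are ignored.
members : (S : Setoid o e) → Pred (Setoid.Carrier S) m → Setoid (o ⊔ m) e
members S P = On.setoid {B = ∃ P} S proj₁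

-- Finite or countably infinite, possibly empty: there is an enumeration,
-- possibly with gaps and repetitions.
Countable : Setoid o e → Set (o ⊔ e)
Countable S = Σ (ℕ → Maybe Carrier) λ enum → ∀ x → ∃ λ n → Any (_≈ x) (enum n)
  where open Setoid S

-- Countability is an irrelevant field because it is a property of the sets of
-- relations and functions: the choice of an enumeration is not part of an
-- architecture.
record Architecture (a ℓ m : Level) : Set (suc (a ⊔ ℓ ⊔ m)) where
  field
    Universe  : Set a
    Relations : Pred (Relation Universe ℓ) m
    Functions : Pred (PartialFunction Universe ℓ) m

  𝐑 : Setoid (a ⊔ suc ℓ ⊔ m) (a ⊔ suc ℓ)
  𝐑 = members (relationSetoid Universe ℓ) Relations

  𝐅 : Setoid (a ⊔ suc ℓ ⊔ m) (a ⊔ suc ℓ)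
  𝐅 = members (functionSetoid Universe ℓ) Functions

  field
    .relations-countable : Countable 𝐑
    .functions-countable : Countable 𝐅

open Architecture public using (Universe; 𝐑; 𝐅)

-- A triple of maps ⟨h₀, h_R, h_F⟩, not yet subject to any condition.  Maps out
-- of a set of relations or functions respect extensional equality.
record Triple (𝒜 ℬ : Architecture a ℓ m) : Set (a ⊔ suc ℓ ⊔ m) where
  constructor ⟨_,_,_⟩
  field
    map₀ : Universe 𝒜 → Universe ℬ
    mapᴿ : Func (𝐑 𝒜) (𝐑 ℬ)
    mapᶠ : Func (𝐅 𝒜) (𝐅 ℬ)

record _≈ᵀ_ {𝒜 ℬ : Architecture a ℓ m} (f g : Triple 𝒜 ℬ) :
            Set (a ⊔ suc ℓ ⊔ m) where
  private
    module f = Triple f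
    module g = Triple g
  field
    eq₀ : f.map₀ ≗ g.map₀
    eqᴿ : ∀ R → Setoid._≈_ (𝐑 ℬ) (f.mapᴿ ⟨$⟩ R) (g.mapᴿ ⟨$⟩ R)
    eqᶠ : ∀ φ → Setoid._≈_ (𝐅 ℬ) (f.mapᶠ ⟨$⟩ φ) (g.mapᶠ ⟨$⟩ φ)

idᵀ : (𝒜 : Architecture a ℓ m) → Triple 𝒜 𝒜
idᵀ 𝒜 = ⟨ id , Identity.function (𝐑 𝒜) , Identity.function (𝐅 𝒜) ⟩

infixr 9 _∘ᵀ_

_∘ᵀ_ : {𝒜 ℬ 𝒞 : Architecture a ℓ m} → Triple ℬ 𝒞 → Triple 𝒜 ℬ → Triple 𝒜 𝒞
⟨ g₀ , gᴿ , gᶠ ⟩ ∘ᵀ ⟨ f₀ , fᴿ , fᶠ ⟩ =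
  ⟨ g₀ ∘ f₀ , Composition.function fᴿ gᴿ , Composition.function fᶠ gᶠ ⟩

-- The casts only transport tuples along the preservation of arity.
record IsHomomorphism {𝒜 ℬ : Architecture a ℓ m} (t : Triple 𝒜 ℬ) :
                      Set (a ⊔ suc ℓ ⊔ m) where
  open Triple t
  open Relation using (holds)
  open PartialFunction using (dom; apply)

  field
    arityᴿ : ∀ R → Relation.arity (proj₁ (mapᴿ ⟨$⟩ R)) ≡ Relation.arity (proj₁ R)
    arityᶠ : ∀ f → PartialFunction.arity (proj₁ (mapᶠ ⟨$⟩ f)) ≡
                   PartialFunction.arity (proj₁ f)

    preservesᴿ : ∀ R v → v ∈ holds (proj₁ R) →
                 cast (sym (arityᴿ R)) (map map₀ v) ∈ holds (proj₁ (mapᴿ ⟨$⟩ R))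

    preservesᶠ : ∀ f v (p : v ∈ dom (proj₁ f)) →
                 let g = proj₁ (mapᶠ ⟨$⟩ f)
                     w = cast (sym (arityᶠ f)) (map map₀ v)
                 in Σ (w ∈ dom g) λ q → map₀ (apply (proj₁ f) v p) ≡ apply g w q

record Homomorphism (𝒜 ℬ : Architecture a ℓ m) : Set (a ⊔ suc ℓ ⊔ m) where
  field
    triple         : Triple 𝒜 ℬ
    isHomomorphism : IsHomomorphism triple

open Homomorphism public using (triple)

-- Membership is irrelevant, so each member of 𝔸 is exactly one object.
Object : Pred (Architecture a ℓ m) s → Set (suc (a ⊔ ℓ ⊔ m) ⊔ s)
Object 𝔸 = Refinement (Architecture _ _ _) 𝔸

ℍ : (𝔸 : Pred (Architecture a ℓ m) s) → Object 𝔸 → Object 𝔸 → Set (a ⊔ suc ℓ ⊔ m)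
ℍ 𝔸 X Y = Homomorphism (value X) (value Y)

-- Homomorphisms are equal when their triples of maps are.
_≈ᴴ_ : {𝒜 ℬ : Architecture a ℓ m} → Rel (Homomorphism 𝒜 ℬ) (a ⊔ suc ℓ ⊔ m)
_≈ᴴ_ = _≈ᵀ_ on triple

-- The structure making given objects and arrows into a category, with arrows
-- compared by a given relation.
record CategoryOn (Obj : Set o) (_⇒_ : Obj → Obj → Set h)
                  (_≈_ : ∀ {X Y} → Rel (X ⇒ Y) e) : Set (o ⊔ h ⊔ e) where
  infixr 9 _∙_
  field
    ι   : ∀ {X} → X ⇒ X
    _∙_ : ∀ {X Y Z} → Y ⇒ Z → X ⇒ Y → X ⇒ Z

    ≈-isEquivalence : ∀ {X Y} → IsEquivalence (_≈_ {X} {Y})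
    ∙-cong    : ∀ {X Y Z} {g g′ : Y ⇒ Z} {f f′ : X ⇒ Y} →
                g ≈ g′ → f ≈ f′ → (g ∙ f) ≈ (g′ ∙ f′)
    assoc     : ∀ {W X Y Z} (k : Y ⇒ Z) (g : X ⇒ Y) (f : W ⇒ X) →
                ((k ∙ g) ∙ f) ≈ (k ∙ (g ∙ f))
    identityˡ : ∀ {X Y} (f : X ⇒ Y) → (ι ∙ f) ≈ f
    identityʳ : ∀ {X Y} (f : X ⇒ Y) → (f ∙ ι) ≈ f

{-# OPTIONS --safe #-}
module Submission where

open import Defs
open import Data.Product.Base using (Σ; Σ-syntax; _×_; _,_; proj₁)
open import Data.Refinement using (value)
open import Data.Vec.Base using (Vec; map; cast)
open import Data.Vec.Properties using (cast-is-id; cast-trans; map-id; map-∘; map-cast)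
open import Function.Base using (id; _∘_)
open import Function.Bundles using (Func; _⟨$⟩_)
open import Level using (Level)
import Relation.Binary.Construct.On as On
open import Relation.Binary.PropositionalEquality
  using (_≡_; refl; sym; trans; cong; subst; module ≡-Reasoning)
open import Relation.Binary.Structures using (IsEquivalence)
open import Relation.Unary using (Pred; _∈_)

-- Identities and composites are formed componentwise on triples, and arrows are compared only
-- through their triples, so the category laws are the laws for composing maps. What needs proof is
-- closure: `idᵀ` and the composite of two homomorphisms must again satisfy the conditions on
-- relations and functions. The conditions chain directly; the one complication is that tuples are
-- transported along arity equations, so a tuple transported in two stages must be matched with the
-- one transported once (`cast-map-∘`).

private
  variable
    a b c ℓ m : Level
    A : Set a
    B : Set b
    C : Set c
    𝒜 ℬ 𝒞 : Architecture a ℓ m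

cast-map-id : ∀ {n} .(eq : n ≡ n) (v : Vec A n) → cast eq (map id v) ≡ v
cast-map-id eq v = trans (cast-is-id eq (map id v)) (map-id v)

-- Transport commutes with `map`, so both casts can be moved outermost and merged. The left side is
-- the tuple reached by two homomorphisms in turn, the right side the one demanded of their
-- composite.
cast-map-∘ : ∀ {i j k} (g : B → C) (f : A → B)
             .(p : i ≡ j) .(q : j ≡ k) .(r : i ≡ k) (v : Vec A i) →
             cast q (map g (cast p (map f v))) ≡ cast r (map (g ∘ f) v)
cast-map-∘ g f p q r v = begin
  cast q (map g (cast p (map f v)))  ≡⟨ cong (cast q) (map-cast g p (map f v)) ⟩
  cast q (cast p (map g (map f v)))  ≡⟨ cast-trans p q (map g (map f v)) ⟩
  cast r (map g (map f v))           ≡⟨ cong (cast r) (map-∘ g f v) ⟨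
  cast r (map (g ∘ f) v)             ∎
  where open ≡-Reasoning

module _ (φ : PartialFunction A ℓ) where
  open PartialFunction φ

  -- The graph of `φ`. Pairing definedness with the value lets a single `subst` along an equality of
  -- tuples carry both, although `apply` takes the membership proof as an argument.
  _↦_ : Vec A arity → A → Set _
  v ↦ x = Σ (v ∈ dom) λ p → x ≡ apply v p

module ≈ᴿ {a} {A : Set a} {ℓ} = IsEquivalence (≈ᴿ-isEquivalence {a} {ℓ} {A})
module ≈ᶠ {a} {A : Set a} {ℓ} = IsEquivalence (≈ᶠ-isEquivalence {a} {ℓ} {A})

≈ᵀ-refl : {f : Triple 𝒜 ℬ} → f ≈ᵀ f
≈ᵀ-refl = record
  { eq₀ = λ _ → refl
  ; eqᴿ = λ _ → ≈ᴿ.refl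
  ; eqᶠ = λ _ → ≈ᶠ.refl
  }

≈ᵀ-sym : {f g : Triple 𝒜 ℬ} → f ≈ᵀ g → g ≈ᵀ f
≈ᵀ-sym p = record
  { eq₀ = λ x → sym (eq₀ x)
  ; eqᴿ = λ R → ≈ᴿ.sym (eqᴿ R)
  ; eqᶠ = λ φ → ≈ᶠ.sym (eqᶠ φ)
  }
  where open _≈ᵀ_ p

≈ᵀ-trans : {f g h : Triple 𝒜 ℬ} → f ≈ᵀ g → g ≈ᵀ h → f ≈ᵀ h
≈ᵀ-trans p q = record
  { eq₀ = λ x → trans (p.eq₀ x) (q.eq₀ x)
  ; eqᴿ = λ R → ≈ᴿ.trans (p.eqᴿ R) (q.eqᴿ R)
  ; eqᶠ = λ φ → ≈ᶠ.trans (p.eqᶠ φ) (q.eqᶠ φ)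
  }
  where
  module p = _≈ᵀ_ p
  module q = _≈ᵀ_ q

≈ᵀ-isEquivalence : IsEquivalence (_≈ᵀ_ {𝒜 = 𝒜} {ℬ = ℬ})
≈ᵀ-isEquivalence = record { refl = ≈ᵀ-refl ; sym = ≈ᵀ-sym ; trans = ≈ᵀ-trans }

-- Both sides are compared with `g′ ∘ᵀ f`; passing from there to `g′ ∘ᵀ f′` uses that the maps of
-- `g′` respect extensional equality.
∘ᵀ-cong : {g g′ : Triple ℬ 𝒞} {f f′ : Triple 𝒜 ℬ} →
          g ≈ᵀ g′ → f ≈ᵀ f′ → (g ∘ᵀ f) ≈ᵀ (g′ ∘ᵀ f′)
∘ᵀ-cong {g′ = g′} {f = f} g≈g′ f≈f′ = record
  { eq₀ = λ x → trans (g≈.eq₀ (f.map₀ x)) (cong g′.map₀ (f≈.eq₀ x))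
  ; eqᴿ = λ R → ≈ᴿ.trans (g≈.eqᴿ (f.mapᴿ ⟨$⟩ R)) (Func.cong g′.mapᴿ (f≈.eqᴿ R))
  ; eqᶠ = λ φ → ≈ᶠ.trans (g≈.eqᶠ (f.mapᶠ ⟨$⟩ φ)) (Func.cong g′.mapᶠ (f≈.eqᶠ φ))
  }
  where
  module g≈ = _≈ᵀ_ g≈g′
  module f≈ = _≈ᵀ_ f≈f′
  module g′ = Triple g′
  module f = Triple f

idᵀ-isHomomorphism : (𝒜 : Architecture a ℓ m) → IsHomomorphism (idᵀ 𝒜)
idᵀ-isHomomorphism 𝒜 = record
  { arityᴿ     = λ _ → refl
  ; arityᶠ     = λ _ → refl
  ; preservesᴿ = λ { (R , _) v p →
      subst (_∈ Relation.holds R) (sym (cast-map-id refl v)) p }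
  ; preservesᶠ = λ { (φ , _) v p →
      subst (λ w → (φ ↦ w) (PartialFunction.apply φ v p))
            (sym (cast-map-id refl v)) (p , refl) }
  }

∘ᵀ-isHomomorphism : {g : Triple ℬ 𝒞} {f : Triple 𝒜 ℬ} →
                    IsHomomorphism g → IsHomomorphism f → IsHomomorphism (g ∘ᵀ f)
∘ᵀ-isHomomorphism {g = g} {f = f} g-hom f-hom = record
  { arityᴿ     = arityᴿ
  ; arityᶠ     = arityᶠ
  ; preservesᴿ = λ R v p →
      subst (_∈ Relation.holds (proj₁ (g.mapᴿ ⟨$⟩ (f.mapᴿ ⟨$⟩ R))))
            (cast-map-∘ g.map₀ f.map₀ (sym (f-hom.arityᴿ R))
              (sym (g-hom.arityᴿ (f.mapᴿ ⟨$⟩ R))) (sym (arityᴿ R)) v)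
            (g-hom.preservesᴿ (f.mapᴿ ⟨$⟩ R) _ (f-hom.preservesᴿ R v p))
  ; preservesᶠ = λ φ v p →
      -- `q` says that the image of `φ` under `f` is defined at the image tuple, which is exactly
      -- what the condition on `g` asks for.
      let q , f-eq = f-hom.preservesᶠ φ v p
          r , g-eq = g-hom.preservesᶠ (f.mapᶠ ⟨$⟩ φ) _ q
          x        = g.map₀ (f.map₀ (PartialFunction.apply (proj₁ φ) v p))
      in subst (λ w → (proj₁ (g.mapᶠ ⟨$⟩ (f.mapᶠ ⟨$⟩ φ)) ↦ w) x)
               (cast-map-∘ g.map₀ f.map₀ (sym (f-hom.arityᶠ φ))
                 (sym (g-hom.arityᶠ (f.mapᶠ ⟨$⟩ φ))) (sym (arityᶠ φ)) v)
               (r , trans (cong g.map₀ f-eq) g-eq)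
  }
  where
  module g = Triple g
  module f = Triple f
  module g-hom = IsHomomorphism g-hom
  module f-hom = IsHomomorphism f-hom
  arityᴿ = λ R → trans (g-hom.arityᴿ (f.mapᴿ ⟨$⟩ R)) (f-hom.arityᴿ R)
  arityᶠ = λ φ → trans (g-hom.arityᶠ (f.mapᶠ ⟨$⟩ φ)) (f-hom.arityᶠ φ)

idᴴ : (𝒜 : Architecture a ℓ m) → Homomorphism 𝒜 𝒜
idᴴ 𝒜 = record { isHomomorphism = idᵀ-isHomomorphism 𝒜 }

_∘ᴴ_ : Homomorphism ℬ 𝒞 → Homomorphism 𝒜 ℬ → Homomorphism 𝒜 𝒞
g ∘ᴴ f = record
  { isHomomorphism = ∘ᵀ-isHomomorphism (Homomorphism.isHomomorphism g)
                                       (Homomorphism.isHomomorphism f) }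

≈ᴴ-isEquivalence : IsEquivalence (_≈ᴴ_ {𝒜 = 𝒜} {ℬ = ℬ})
≈ᴴ-isEquivalence = On.isEquivalence triple ≈ᵀ-isEquivalence

corollary1 : ∀ {a ℓ m s : Level} (𝔸 : Pred (Architecture a ℓ m) s) →
    Σ[ 𝒞 ∈ CategoryOn (Object 𝔸) (ℍ 𝔸) _≈ᴴ_ ]
    let open CategoryOn 𝒞 in
    (∀ (X : Object 𝔸) → triple (ι {X}) ≈ᵀ idᵀ (value X)) ×
    (∀ {X Y Z : Object 𝔸} (g : ℍ 𝔸 Y Z) (f : ℍ 𝔸 X Y) →
    triple (_∙_ {X} {Y} {Z} g f) ≈ᵀ (triple g ∘ᵀ triple f))
corollary1 𝔸 = category , (λ _ → ≈ᵀ-refl) , (λ _ _ → ≈ᵀ-refl)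
  where
  category : CategoryOn (Object 𝔸) (ℍ 𝔸) _≈ᴴ_
  category = record
    { ι               = λ {X} → idᴴ (value X)
    ; _∙_             = _∘ᴴ_
    ; ≈-isEquivalence = ≈ᴴ-isEquivalence
    ; ∙-cong          = ∘ᵀ-cong
    -- In each of the three laws the two underlying triples agree by computation, including their
    -- congruence proofs.
    ; assoc           = λ _ _ _ → ≈ᵀ-refl
    ; identityˡ       = λ _ → ≈ᵀ-refl
    ; identityʳ       = λ _ → ≈ᵀ-refl
    }
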